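{- Let $E=\{e_1,\dots,e_n\}$ be a finite set and let $\mathcal{R}$ be the quantitative theory of reading computations of type $E$. The monads $\mathbb{C}T_{\mathcal{R}}$ and $(-)^{\underline{E}}$ on $\mathbf{CMet}$ are isomorphic.
   Context: An extended metric space is a set $X$ with $d_X:X\times X\to[0,\infty]$ satisfying $d_X(x,y)=0$ iff $x=y$, symmetry and the triangle inequality. $\mathbf{Met}$ is the category of extended metric spaces and non-expansive maps; $\mathbf{CMet}$ is its full subcategory of (Cauchy) complete spaces. Quantitative theories. A signature $\Sigma$ is a set of function symbols $f:n$ of finite arity $n\in\mathbb{N}$. Fix a countably infinite set of variables $V$; terms are $\Sigma$-terms over $V$. A quantitative equation is an expression $t=_\varepsilon s$ with $t,s$ terms and $\varepsilon\in\mathbb{Q}_{\ge0}$. A conditional quantitative equation is $\Gamma\vdash t=_\varepsilon s$ with $\Gamma$ a finite set of quantitative equations. A quantitative equational theory of type $\Sigma$ is a set $\mathcal{U}$ of conditional quantitative equations containing (for all variables and rationals $\varepsilon,\varepsilon'\ge 0$) $\vdash x=_0x$; $\{x=_\varepsilon y\}\vdash y=_\varepsilon x$; $\{x=_\varepsilon z,z=_{\varepsilon'}y\}\vdash x=_{\varepsilon+\varepsilon'}y$; $\{x=_\varepsilon y\}\vdash x=_{\varepsilon+\varepsilon'}y$ for $\varepsilon'>0$; $\{x_i=_\varepsilon y_i\mid i=1,\dots,n\}\vdash f(x_1,\dots,x_n)=_\varepsilon f(y_1,\dots,y_n)$ for $f:n\in\Sigma$; and closed under: continuity (if $\Gamma\vdash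 t=_{\varepsilon'}s\in\mathcal{U}$ for all $\varepsilon'>\varepsilon$ then $\Gamma\vdash t=_\varepsilon s\in\mathcal{U}$), substitution of terms for variables, assumption ($\Gamma\vdash\phi\in\mathcal{U}$ whenever $\phi\in\Gamma$), and cut (if $\Gamma\vdash\phi\in\mathcal{U}$ for all $\phi\in\Theta$ and $\Theta\vdash\psi\in\mathcal{U}$ then $\Gamma\vdash\psi\in\mathcal{U}$). A set $A$ of conditional quantitative equations axiomatizes $\mathcal{U}$ if $\mathcal{U}$ is the smallest theory containing $A$. Models. A quantitative $\Sigma$-algebra is an extended metric space $A$ with, for each $f:n\in\Sigma$, a map $f^A:A^n\to A$ that is non-expansive for the max metric on $A^n$. It satisfies $\Gamma\vdash t=_\varepsilon s$ if for every assignment $\iota:V\to A$ (extended homomorphically to terms), $d_A(\iota(t'),\iota(s'))\le\varepsilon'$ for all $t'=_{\varepsilon'}s'\in\Gamma$ implies $d_A(\iota(t),\iota(s))\le\varepsilon$. $\mathbb{C}\mathbb{K}(\Sigma,\mathcal{U})$ is the category of quantitative $\Sigma$-algebras with complete carrier satisfying all members of $\mathcal{U}$, with non-expansive $\Sigma$-homomorphisms. For the theory $\mathcal{U}=\mathcal{R}$ below (and more generally for "continuous" theories) the forgetful functor $\mathbb{C}\mathbb{K}(\Sigma,\mathcal{U})\to\mathbf{CMet}$ has a left adjoint (known), sending $X$ to the Cauchy completion of the free quantitative algebra on $X$ satisfying $\mathcal{U}$; the induced monad on $\mathbf{CMet}$ is denoted $\mathbb{C}T_{\mathcal{U}}$.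 Reader theory. $\mathcal{R}$ has signature $\{\mathsf{r}:n\}$, $n=|E|$, and is axiomatized by $\vdash x=_0\mathsf{r}(x,\dots,x)$ and $\vdash\mathsf{r}(x_{1,1},\dots,x_{n,n})=_0\mathsf{r}(\mathsf{r}(x_{1,1},\dots,x_{1,n}),\dots,\mathsf{r}(x_{n,1},\dots,x_{n,n}))$. Reader monad. $\underline{E}$ is $E$ with the discrete metric (distance $\infty$ between distinct points). $X^{\underline{E}}$ is the set of all maps $E\to X$ with metric $\sup_{e\in E}d_X(f(e),g(e))$ (complete when $X$ is); on morphisms $f^{\underline{E}}(g)=f\circ g$. The unit is $\kappa_X(x)(e)=x$ and the multiplication is $\zeta_X(g)(e)=g(e)(e)$ for $g\in(X^{\underline{E}})^{\underline{E}}$. -}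

module Defs where

open import Data.Fin.Base using (Fin; zero; suc)
open import Data.List.Base using (List; []; _∷_; map; tabulate)
open import Data.List.Membership.Propositional using (_∈_)
open import Data.Nat.Base as ℕ using (ℕ)
import Data.Nat.Properties as ℕ
open import Data.Product using (∃; ∃₂; _×_; _,_; proj₁; proj₂)
open import Data.Rational.Base as ℚ using (ℚ; 0ℚ)
import Data.Rational.Properties as ℚ
open import Data.Unit.Base using (⊤)
open import Function.Base using (_∘_)
open import Function.Bundles using (_↔_; module Inverse; _⇔_; mk⇔; module Equivalence)
open import Level using (Level; _⊔_) renaming (suc to lsuc)
open import Relation.Binary.Core using (Rel)
open import Relation.Binary.Structures using (IsEquivalence)
open import Relation.Binary.PropositionalEquality using (refl; subst)
open import Relation.Nullary.Decidable using (yes; no)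
open import Relation.Nullary.Negation using (contradiction; contradiction-irr)

record ℚ≥0 : Set where
  constructor mkℚ≥0
  field
    value   : ℚ
    .nonNeg : 0ℚ ℚ.≤ value

open ℚ≥0 public

infix 4 _≤⁺_ _<⁺_
infixl 6 _+⁺_

_≤⁺_ _<⁺_ : ℚ≥0 → ℚ≥0 → Set
p ≤⁺ q = value p ℚ.≤ value q
p <⁺ q = value p ℚ.< value q

0⁺ : ℚ≥0
0⁺ = mkℚ≥0 0ℚ ℚ.≤-refl

0≤⁺ : ∀ q → 0⁺ ≤⁺ q
0≤⁺ (mkℚ≥0 q q≥0) with 0ℚ ℚ.≤? q
... | yes 0≤q = 0≤q
... | no  0≰q = contradiction-irr q≥0 0≰q

_+⁺_ : ℚ≥0 → ℚ≥0 → ℚ≥0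
mkℚ≥0 p p≥0 +⁺ mkℚ≥0 q q≥0 = mkℚ≥0 (p ℚ.+ q) (ℚ.+-mono-≤ p≥0 q≥0)

dense⁺ : ∀ {p q} → p <⁺ q → ∃ λ m → p <⁺ m × m <⁺ q
dense⁺ {mkℚ≥0 p p≥0} p<q with ℚ.<-dense p<q
... | m , p<m , m<q = mkℚ≥0 m (ℚ.≤-trans p≥0 (ℚ.<⇒≤ p<m)) , p<m , m<q

≤⁺-closed : ∀ p q → (∀ q′ → q <⁺ q′ → p ≤⁺ q′) → p ≤⁺ q
≤⁺-closed p q h with value p ℚ.≤? value q
... | yes p≤q = p≤q
... | no  p≰q with dense⁺ {q} {p} (ℚ.≰⇒> p≰q)
...   | m , q<m , m<p = contradiction (ℚ.≤-<-trans (h m q<m) m<p) (ℚ.<-irrefl refl)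

-- r ∈ [0,∞] is given by the set { q ∈ ℚ≥0 ∣ r ≤ q } of its rational upper
-- bounds: an up-set containing p as soon as it contains all q > p. The empty
-- set is ∞. Classically this is a bijection with the extended half-line.
record [0,∞] : Set₁ where
  field
    _≼_    : ℚ≥0 → Set
    upward : ∀ {p q} → p ≤⁺ q → _≼_ p → _≼_ q
    closed : ∀ {p} → (∀ q → p <⁺ q → _≼_ q) → _≼_ p

open [0,∞] public using (_≼_)

infix 4 _≤∞_ _≈∞_
infixl 6 _+∞_

_≤∞_ : [0,∞] → [0,∞] → Set
r ≤∞ s = ∀ q → s ≼ q → r ≼ q

_≈∞_ : [0,∞] → [0,∞] → Set
r ≈∞ s = r ≤∞ s × s ≤∞ r

fromℚ≥0 : ℚ≥0 → [0,∞]
fromℚ≥0 p = record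
  { _≼_    = λ q → p ≤⁺ q
  ; upward = λ q≤q′ p≤q → ℚ.≤-trans p≤q q≤q′
  ; closed = λ {q} → ≤⁺-closed p q
  }

0∞ : [0,∞]
0∞ = fromℚ≥0 0⁺

-- r + s ≤ q iff every q′ > q dominates a + b for some rationals a ≥ r, b ≥ s.
_+∞_ : [0,∞] → [0,∞] → [0,∞]
r +∞ s = record
  { _≼_    = λ q → ∀ q′ → q <⁺ q′ → ∃₂ λ a b → r ≼ a × s ≼ b × a +⁺ b ≤⁺ q′
  ; upward = λ p≤q h q′ q<q′ → h q′ (ℚ.≤-<-trans p≤q q<q′)
  ; closed = λ {p} h q p<q → let m , p<m , m<q = dense⁺ {p} {q} p<q in h m p<m q m<q
  }

sup : {I : Set} → (I → [0,∞]) → [0,∞]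
sup r = record
  { _≼_    = λ q → ∀ i → r i ≼ q
  ; upward = λ p≤q h i → [0,∞].upward (r i) p≤q (h i)
  ; closed = λ h i → [0,∞].closed (r i) λ q p<q → h q p<q i
  }

record Category (o ℓ e : Level) : Set (lsuc (o ⊔ ℓ ⊔ e)) where
  infix  4 _≈_
  infixr 9 _·_
  field
    Obj     : Set o
    Hom     : Obj → Obj → Set ℓ
    _≈_     : ∀ {A B} → Rel (Hom A B) e
    id      : ∀ {A} → Hom A A
    _·_     : ∀ {A B C} → Hom B C → Hom A B → Hom A C
    equiv   : ∀ {A B} → IsEquivalence (_≈_ {A} {B})
    idˡ     : ∀ {A B} (f : Hom A B) → id · f ≈ f
    idʳ     : ∀ {A B} (f : Hom A B) → f · id ≈ f
    assoc   : ∀ {A B C D} (h : Hom C D) (g : Hom B C) (f : Hom A B) →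
              (h · g) · f ≈ h · (g · f)
    ·-cong  : ∀ {A B C} {f f′ : Hom B C} {g g′ : Hom A B} →
              f ≈ f′ → g ≈ g′ → f · g ≈ f′ · g′

  module ≈ {A B} = IsEquivalence (equiv {A} {B})

record Functor {o ℓ e o′ ℓ′ e′} (𝒞 : Category o ℓ e) (𝒟 : Category o′ ℓ′ e′) :
       Set (o ⊔ ℓ ⊔ e ⊔ o′ ⊔ ℓ′ ⊔ e′) where
  private
    module 𝒞 = Category 𝒞
    module 𝒟 = Category 𝒟
  field
    F₀     : 𝒞.Obj → 𝒟.Obj
    F₁     : ∀ {A B} → 𝒞.Hom A B → 𝒟.Hom (F₀ A) (F₀ B)
    F-id   : ∀ {A} → F₁ (𝒞.id {A}) 𝒟.≈ 𝒟.id
    F-·    : ∀ {A B C} (g : 𝒞.Hom B C) (f : 𝒞.Hom A B) → F₁ (g 𝒞.· f) 𝒟.≈ F₁ g 𝒟.· F₁ f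
    F-cong : ∀ {A B} {f g : 𝒞.Hom A B} → f 𝒞.≈ g → F₁ f 𝒟.≈ F₁ g

module _ {o ℓ e} {𝒞 : Category o ℓ e} where
  open Category 𝒞

  idF : Functor 𝒞 𝒞
  idF = record
    { F₀ = λ A → A ; F₁ = λ f → f ; F-id = ≈.refl
    ; F-· = λ _ _ → ≈.refl ; F-cong = λ eq → eq }

infixr 9 _∘F_
_∘F_ : ∀ {o ℓ e o′ ℓ′ e′ o″ ℓ″ e″}
         {𝒞 : Category o ℓ e} {𝒟 : Category o′ ℓ′ e′} {ℰ : Category o″ ℓ″ e″} →
       Functor 𝒟 ℰ → Functor 𝒞 𝒟 → Functor 𝒞 ℰ
_∘F_ {ℰ = ℰ} G F = record
  { F₀ = λ A → G.F₀ (F.F₀ A) ; F₁ = λ f → G.F₁ (F.F₁ f)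
  ; F-id = ≈.trans (G.F-cong F.F-id) G.F-id
  ; F-· = λ g f → ≈.trans (G.F-cong (F.F-· g f)) (G.F-· _ _)
  ; F-cong = λ eq → G.F-cong (F.F-cong eq) }
  where
  open Category ℰ
  module F = Functor F
  module G = Functor G

record NatTrans {o ℓ e o′ ℓ′ e′} {𝒞 : Category o ℓ e} {𝒟 : Category o′ ℓ′ e′}
                (F G : Functor 𝒞 𝒟) : Set (o ⊔ ℓ ⊔ e ⊔ o′ ⊔ ℓ′ ⊔ e′) where
  private
    module 𝒞 = Category 𝒞
    module F = Functor F
    module G = Functor G
  open Category 𝒟
  field
    at      : ∀ A → Hom (F.F₀ A) (G.F₀ A)
    natural : ∀ {A B} (f : 𝒞.Hom A B) → at B · F.F₁ f ≈ G.F₁ f · at A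

record Monad {o ℓ e} (𝒞 : Category o ℓ e) : Set (o ⊔ ℓ ⊔ e) where
  open Category 𝒞
  field
    T : Functor 𝒞 𝒞
    η : NatTrans idF T
    μ : NatTrans (T ∘F T) T
  open Functor T public renaming (F₀ to T₀; F₁ to T₁; F-id to T-id; F-· to T-·; F-cong to T-cong)
  module η = NatTrans η
  module μ = NatTrans μ
  field
    unitˡ : ∀ A → μ.at A · T₁ (η.at A) ≈ id
    unitʳ : ∀ A → μ.at A · η.at (T₀ A) ≈ id
    μ-assoc : ∀ A → μ.at A · T₁ (μ.at A) ≈ μ.at A · μ.at (T₀ A)

infix 4 _≅ᴹ_
record _≅ᴹ_ {o ℓ e} {𝒞 : Category o ℓ e} (M N : Monad 𝒞) : Set (o ⊔ ℓ ⊔ e) where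
  open Category 𝒞
  private
    module M = Monad M
    module N = Monad N
  field
    to   : NatTrans M.T N.T
    from : NatTrans N.T M.T
  module to = NatTrans to
  module from = NatTrans from
  field
    to∘from : ∀ A → to.at A · from.at A ≈ id
    from∘to : ∀ A → from.at A · to.at A ≈ id
    to-η    : ∀ A → to.at A · M.η.at A ≈ N.η.at A
    to-μ    : ∀ A → to.at A · M.μ.at A ≈ N.μ.at A · (N.T₁ (to.at A) · to.at (M.T₀ A))

record LeftAdjoint {o ℓ e o′ ℓ′ e′} {𝒞 : Category o ℓ e} {𝒟 : Category o′ ℓ′ e′}
                   (G : Functor 𝒟 𝒞) : Set (o ⊔ ℓ ⊔ e ⊔ o′ ⊔ ℓ′ ⊔ e′) where
  private
    module 𝒞 = Category 𝒞
    module 𝒟 = Category 𝒟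
    module G = Functor G
  field
    F      : Functor 𝒞 𝒟
    unit   : NatTrans idF (G ∘F F)
    counit : NatTrans (F ∘F G) idF
  module F = Functor F
  module unit = NatTrans unit
  module counit = NatTrans counit
  field
    zig : ∀ A → counit.at (F.F₀ A) 𝒟.· F.F₁ (unit.at A) 𝒟.≈ 𝒟.id
    zag : ∀ B → G.F₁ (counit.at B) 𝒞.· unit.at (G.F₀ B) 𝒞.≈ 𝒞.id

module _ {o ℓ e o′ ℓ′ e′} {𝒞 : Category o ℓ e} {𝒟 : Category o′ ℓ′ e′}
         {G : Functor 𝒟 𝒞} (L : LeftAdjoint G) where
  private
    module 𝒟 = Category 𝒟
    module G = Functor G
  open LeftAdjoint L
  open Category 𝒞

  inducedMonad : Monad 𝒞
  inducedMonad = record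
    { T = G ∘F F
    ; η = unit
    ; μ = record
      { at      = λ A → G.F₁ (counit.at (F.F₀ A))
      ; natural = λ f → push (counit.natural (F.F₁ f)) }
    ; unitˡ   = λ A → ≈.trans (≈.sym (G.F-· _ _)) (≈.trans (G.F-cong (zig A)) G.F-id)
    ; unitʳ   = λ A → zag (F.F₀ A)
    ; μ-assoc = λ A → push (counit.natural (counit.at (F.F₀ A)))
    }
    where
    push : ∀ {A B B′ C} {f : 𝒟.Hom B C} {g : 𝒟.Hom A B} {f′ : 𝒟.Hom B′ C} {g′ : 𝒟.Hom A B′} →
           f 𝒟.· g 𝒟.≈ f′ 𝒟.· g′ → G.F₁ f · G.F₁ g ≈ G.F₁ f′ · G.F₁ g′
    push eq = ≈.trans (≈.sym (G.F-· _ _)) (≈.trans (G.F-cong eq) (G.F-· _ _))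

record MetricSpace : Set₁ where
  infix 4 _≈_
  field
    Carrier       : Set
    _≈_           : Rel Carrier _
    isEquivalence : IsEquivalence _≈_
    d             : Carrier → Carrier → [0,∞]
    separated     : ∀ {x y} → d x y ≈∞ 0∞ ⇔ x ≈ y
    d-sym         : ∀ x y → d x y ≈∞ d y x
    triangle      : ∀ x y z → d x z ≤∞ d x y +∞ d y z

  open IsEquivalence isEquivalence public
    renaming (refl to ≈-refl; sym to ≈-sym; trans to ≈-trans)

-- Non-expansive maps respect ≈, since d x y = 0 iff x ≈ y.
infix 4 _⇒_
record _⇒_ (X Y : MetricSpace) : Set where
  private
    module X = MetricSpace X
    module Y = MetricSpace Y
  field
    fun          : X.Carrier → Y.Carrier
    nonExpansive : ∀ x y → Y.d (fun x) (fun y) ≤∞ X.d x y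

  fun-cong : ∀ {x y} → x X.≈ y → fun x Y.≈ fun y
  fun-cong {x} {y} x≈y = Equivalence.to Y.separated
    ( (λ q 0≤q → nonExpansive x y q (proj₁ (Equivalence.from X.separated x≈y) q 0≤q))
    , (λ q _ → 0≤⁺ q) )

open _⇒_ public using (fun)

module _ {X Y : MetricSpace} where
  _≐_ : Rel (X ⇒ Y) _
  f ≐ g = ∀ x → MetricSpace._≈_ Y (fun f x) (fun g x)

  ≐-isEquivalence : IsEquivalence _≐_
  ≐-isEquivalence = record
    { refl = λ _ → Y.≈-refl ; sym = λ p x → Y.≈-sym (p x) ; trans = λ p q x → Y.≈-trans (p x) (q x) }
    where module Y = MetricSpace Y

id⇒ : ∀ {X} → X ⇒ X
id⇒ = record { fun = λ x → x ; nonExpansive = λ _ _ _ h → h }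

infixr 9 _∘⇒_
_∘⇒_ : ∀ {X Y Z} → Y ⇒ Z → X ⇒ Y → X ⇒ Z
g ∘⇒ f = record
  { fun = fun g ∘ fun f
  ; nonExpansive = λ x y q h → _⇒_.nonExpansive g _ _ q (_⇒_.nonExpansive f x y q h) }

module _ (X : MetricSpace) where
  open MetricSpace X

  IsCauchy : (ℕ → Carrier) → Set
  IsCauchy s = ∀ ε → 0⁺ <⁺ ε → ∃ λ N → ∀ m n → N ℕ.≤ m → N ℕ.≤ n →
               d (s m) (s n) ≤∞ fromℚ≥0 ε

  _ConvergesTo_ : (ℕ → Carrier) → Carrier → Set
  s ConvergesTo x = ∀ ε → 0⁺ <⁺ ε → ∃ λ N → ∀ n → N ℕ.≤ n → d (s n) x ≤∞ fromℚ≥0 ε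

  Complete : Set
  Complete = ∀ s → IsCauchy s → ∃ λ x → s ConvergesTo x

CMet : Category _ _ _
CMet = record
  { Obj = ∃ Complete
  ; Hom = λ X Y → proj₁ X ⇒ proj₁ Y
  ; _≈_ = _≐_
  ; id = id⇒
  ; _·_ = _∘⇒_
  ; equiv = λ {X} {Y} → ≐-isEquivalence {proj₁ X} {proj₁ Y}
  ; idˡ = λ {_} {Y} _ _ → MetricSpace.≈-refl (proj₁ Y)
  ; idʳ = λ {_} {Y} _ _ → MetricSpace.≈-refl (proj₁ Y)
  ; assoc = λ {_} {_} {_} {W} _ _ _ _ → MetricSpace.≈-refl (proj₁ W)
  ; ·-cong = λ {_} {_} {Z} {f} p q x →
      MetricSpace.≈-trans (proj₁ Z) (_⇒_.fun-cong f (q x)) (p _)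
  }

-- All maps I → X with the supremum metric: the max metric on powers Aⁿ
-- when I = Fin n, and X^E̲ when I = E (every map out of a discrete space is
-- non-expansive).
Power : MetricSpace → Set → MetricSpace
Power X I = record
  { Carrier       = I → X.Carrier
  ; _≈_           = λ f g → ∀ i → f i X.≈ g i
  ; isEquivalence = record
    { refl = λ _ → X.≈-refl ; sym = λ p i → X.≈-sym (p i) ; trans = λ p q i → X.≈-trans (p i) (q i) }
  ; d             = λ f g → sup λ i → X.d (f i) (g i)
  ; separated     = λ {f} {g} → mk⇔
      (λ (d≤0 , _) i → Equivalence.to X.separated
         ((λ q 0≤q → d≤0 q 0≤q i) , λ q _ → 0≤⁺ q))
      (λ p → (λ q 0≤q i → proj₁ (Equivalence.from X.separated (p i)) q 0≤q) , λ q _ → 0≤⁺ q)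
  ; d-sym         = λ f g → (λ q h i → proj₁ (X.d-sym (f i) (g i)) q (h i))
                          , (λ q h i → proj₂ (X.d-sym (f i) (g i)) q (h i))
  ; triangle      = λ f g h q le i → X.triangle (f i) (g i) (h i) q λ q′ q<q′ →
      let a , b , fg , gh , a+b≤q′ = le q′ q<q′ in a , b , fg i , gh i , a+b≤q′
  }
  where
  module X = MetricSpace X

record Signature : Set₁ where
  field
    Op    : Set
    arity : Op → ℕ

data Term (S : Signature) (V : Set) : Set where
  var : V → Term S V
  op  : (f : Signature.Op S) → (Fin (Signature.arity S f) → Term S V) → Term S V

Var : Set
Var = ℕ

module _ (S : Signature) where
  open Signature S

  infix 6 _=[_]_
  record QuantEq : Set where
    constructor _=[_]_
    field
      lhs : Term S Var
      ε   : ℚ≥0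
      rhs : Term S Var

  -- The finite set of premises is a list; only membership in it is ever used.
  infix 4 _⊢_
  record CondQuantEq : Set where
    constructor _⊢_
    field
      premises   : List QuantEq
      conclusion : QuantEq

module _ {S : Signature} where
  open Signature S

  infixl 8 _[_] _[_]ᵉ
  _[_] : ∀ {V W} → Term S V → (V → Term S W) → Term S W
  var x   [ σ ] = σ x
  op f ts [ σ ] = op f λ i → ts i [ σ ]

  _[_]ᵉ : QuantEq S → (Var → Term S Var) → QuantEq S
  (t =[ ε ] s) [ σ ]ᵉ = (t [ σ ]) =[ ε ] (s [ σ ])

  -- The conditional equations obtained from members of 𝒰 by a single
  -- application of one of the rules of quantitative theories.
  data Rule (𝒰 : CondQuantEq S → Set) : CondQuantEq S → Set where
    reflexivity  : ∀ x → Rule 𝒰 ([] ⊢ var x =[ 0⁺ ] var x)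
    symmetry     : ∀ x y ε → Rule 𝒰 (var x =[ ε ] var y ∷ [] ⊢ var y =[ ε ] var x)
    transitivity : ∀ x y z ε ε′ →
      Rule 𝒰 (var x =[ ε ] var z ∷ var z =[ ε′ ] var y ∷ [] ⊢ var x =[ ε +⁺ ε′ ] var y)
    weakening    : ∀ x y ε ε′ → 0⁺ <⁺ ε′ →
      Rule 𝒰 (var x =[ ε ] var y ∷ [] ⊢ var x =[ ε +⁺ ε′ ] var y)
    congruence   : ∀ f (x y : Fin (arity f) → Var) ε →
      Rule 𝒰 (tabulate (λ i → var (x i) =[ ε ] var (y i))
               ⊢ op f (λ i → var (x i)) =[ ε ] op f (λ i → var (y i)))
    continuity   : ∀ {Γ t s ε} → (∀ ε′ → ε <⁺ ε′ → 𝒰 (Γ ⊢ t =[ ε′ ] s)) →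
      Rule 𝒰 (Γ ⊢ t =[ ε ] s)
    substitution : ∀ {Γ φ} (σ : Var → Term S Var) → 𝒰 (Γ ⊢ φ) →
      Rule 𝒰 (map _[ σ ]ᵉ Γ ⊢ φ [ σ ]ᵉ)
    assumption   : ∀ {Γ φ} → φ ∈ Γ → Rule 𝒰 (Γ ⊢ φ)
    cut          : ∀ {Γ Θ ψ} → (∀ {φ} → φ ∈ Θ → 𝒰 (Γ ⊢ φ)) → 𝒰 (Θ ⊢ ψ) → Rule 𝒰 (Γ ⊢ ψ)

  IsTheory : (CondQuantEq S → Set) → Set
  IsTheory 𝒰 = ∀ {φ} → Rule 𝒰 φ → 𝒰 φ

  -- The theory axiomatized by 𝒜: a theory containing 𝒜, and the smallest one
-- (Generated-isTheory, axiom, Generated-smallest).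
  data Generated (𝒜 : CondQuantEq S → Set) : CondQuantEq S → Set where
    axiom : ∀ {φ} → 𝒜 φ → Generated 𝒜 φ
    rule  : ∀ {φ} → Rule (Generated 𝒜) φ → Generated 𝒜 φ

  Generated-isTheory : ∀ {𝒜} → IsTheory (Generated 𝒜)
  Generated-isTheory = rule

  Generated-smallest : ∀ {𝒜 𝒰} → IsTheory 𝒰 → (∀ {φ} → 𝒜 φ → 𝒰 φ) →
                       ∀ {φ} → Generated 𝒜 φ → 𝒰 φ
  Generated-smallest th ax (axiom a)                          = ax a
  Generated-smallest th ax (rule (reflexivity x))             = th (reflexivity x)
  Generated-smallest th ax (rule (symmetry x y ε))            = th (symmetry x y ε)
  Generated-smallest th ax (rule (transitivity x y z ε ε′))   = th (transitivity x y z ε ε′)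
  Generated-smallest th ax (rule (weakening x y ε ε′ 0<ε′))   = th (weakening x y ε ε′ 0<ε′)
  Generated-smallest th ax (rule (congruence f x y ε))        = th (congruence f x y ε)
  Generated-smallest th ax (rule (continuity h))              =
    th (continuity λ ε′ ε<ε′ → Generated-smallest th ax (h ε′ ε<ε′))
  Generated-smallest th ax (rule (substitution σ p))          =
    th (substitution σ (Generated-smallest th ax p))
  Generated-smallest th ax (rule (assumption φ∈Γ))            = th (assumption φ∈Γ)
  Generated-smallest th ax (rule (cut h p))                   =
    th (cut (λ φ∈Θ → Generated-smallest th ax (h φ∈Θ)) (Generated-smallest th ax p))

record QuantAlgebra (S : Signature) : Set₁ where
  open Signature S
  field
    space  : MetricSpace
    interp : (f : Op) → Power space (Fin (arity f)) ⇒ space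

  open MetricSpace space

  eval : ∀ {V : Set} → (V → Carrier) → Term S V → Carrier
  eval ι (var x)   = ι x
  eval ι (op f ts) = fun (interp f) λ i → eval ι (ts i)

  Holds : (Var → Carrier) → QuantEq S → Set
  Holds ι (t =[ ε ] s) = d (eval ι t) (eval ι s) ≤∞ fromℚ≥0 ε

  Satisfies : CondQuantEq S → Set
  Satisfies (Γ ⊢ φ) = ∀ ι → (∀ {ψ} → ψ ∈ Γ → Holds ι ψ) → Holds ι φ

record AlgHom {S} (A B : QuantAlgebra S) : Set where
  private
    module A = QuantAlgebra A
    module B = QuantAlgebra B
  open MetricSpace B.space
  field
    map⇒ : A.space ⇒ B.space
    hom  : ∀ f as → fun map⇒ (fun (A.interp f) as) ≈ fun (B.interp f) (λ i → fun map⇒ (as i))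

record CompleteModel {S} (𝒰 : CondQuantEq S → Set) : Set₁ where
  field
    algebra  : QuantAlgebra S
    complete : Complete (QuantAlgebra.space algebra)
    models   : ∀ {φ} → 𝒰 φ → QuantAlgebra.Satisfies algebra φ
  open QuantAlgebra algebra public

ℂ𝕂 : ∀ {S} (𝒰 : CondQuantEq S → Set) → Category _ _ _
ℂ𝕂 𝒰 = record
  { Obj = CompleteModel 𝒰
  ; Hom = λ A B → AlgHom (algebra A) (algebra B)
  ; _≈_ = λ f g → map⇒ f ≐ map⇒ g
  ; id = λ {A} → record { map⇒ = id⇒ ; hom = λ _ _ → MetricSpace.≈-refl (space A) }
  ; _·_ = λ {_} {_} {C} g f → record
      { map⇒ = map⇒ g ∘⇒ map⇒ f
      ; hom = λ o as → MetricSpace.≈-trans (space C) (_⇒_.fun-cong (map⇒ g) (hom f o as)) (hom g o _) }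
  ; equiv = λ {A} {B} → record
      { refl  = λ {f} → Eq.refl A B {map⇒ f}
      ; sym   = λ {f} {g} → Eq.sym A B {map⇒ f} {map⇒ g}
      ; trans = λ {f} {g} {h} → Eq.trans A B {map⇒ f} {map⇒ g} {map⇒ h} }
  ; idˡ = λ {_} {B} _ _ → MetricSpace.≈-refl (space B)
  ; idʳ = λ {_} {B} _ _ → MetricSpace.≈-refl (space B)
  ; assoc = λ {_} {_} {_} {D} _ _ _ _ → MetricSpace.≈-refl (space D)
  ; ·-cong = λ {_} {_} {C} {f} p q x →
      MetricSpace.≈-trans (space C) (_⇒_.fun-cong (map⇒ f) (q x)) (p _)
  }
  where
  open CompleteModel
  open AlgHom
  module Eq A B = IsEquivalence (≐-isEquivalence {space A} {space B})

forgetful : ∀ {S} (𝒰 : CondQuantEq S → Set) → Functor (ℂ𝕂 𝒰) CMet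
forgetful 𝒰 = record
  { F₀ = λ A → space A , complete A
  ; F₁ = AlgHom.map⇒
  ; F-id = λ {A} _ → MetricSpace.≈-refl (space A)
  ; F-· = λ {_} {_} {C} _ _ _ → MetricSpace.≈-refl (space C)
  ; F-cong = λ p → p }
  where open CompleteModel

readerSignature : ℕ → Signature
readerSignature n = record { Op = ⊤ ; arity = λ _ → n }

𝗋 : ∀ {n V} → (Fin n → Term (readerSignature n) V) → Term (readerSignature n) V
𝗋 = op _

-- The variables are arbitrary, not necessarily distinct: theories are closed under
-- substitution, so this generates the same theory.
data ReaderAxiom (n : ℕ) : CondQuantEq (readerSignature n) → Set where
  idempotent : (x : Var) → ReaderAxiom n ([] ⊢ var x =[ 0⁺ ] 𝗋 (λ _ → var x))
  diagonal   : (x : Fin n → Fin n → Var) →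
    ReaderAxiom n ([] ⊢ 𝗋 (λ i → var (x i i)) =[ 0⁺ ] 𝗋 (λ i → 𝗋 λ j → var (x i j)))

ℛ : (n : ℕ) → CondQuantEq (readerSignature n) → Set
ℛ n = Generated (ReaderAxiom n)

uniformBound : ∀ n (P : Fin n → ℕ → Set) → (∀ i → ∃ λ N → ∀ m → N ℕ.≤ m → P i m) →
               ∃ λ N → ∀ m → N ℕ.≤ m → ∀ i → P i m
uniformBound ℕ.zero    P h = 0 , λ _ _ ()
uniformBound (ℕ.suc n) P h =
  let N₀ , h₀ = h zero
      N₁ , h₁ = uniformBound n (P ∘ suc) (h ∘ suc)
  in N₀ ℕ.⊔ N₁ , λ where
       m N≤m zero    → h₀ m (ℕ.≤-trans (ℕ.m≤m⊔n N₀ N₁) N≤m)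
       m N≤m (suc i) → h₁ m (ℕ.≤-trans (ℕ.m≤n⊔m N₀ N₁) N≤m) i

Power-complete : ∀ {n} {E : Set} → Fin n ↔ E → ∀ {X} → Complete X → Complete (Power X E)
Power-complete {n} {E} enum {X} complete s cauchy = limit , converges
  where
  open Inverse enum using (to; from; strictlyInverseˡ)

  pointwise : ∀ e → ∃ λ x → _ConvergesTo_ X (λ m → s m e) x
  pointwise e = complete (λ m → s m e) λ ε ε>0 →
    let N , h = cauchy ε ε>0 in N , λ m m′ N≤m N≤m′ q ε≤q → h m m′ N≤m N≤m′ q ε≤q e

  limit : E → MetricSpace.Carrier X
  limit e = proj₁ (pointwise e)

  converges : _ConvergesTo_ (Power X E) s limit
  converges ε ε>0 =
    let N , h = uniformBound n
                  (λ i m → MetricSpace.d X (s m (to i)) (limit (to i)) ≤∞ fromℚ≥0 ε)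
                  (λ i → proj₂ (pointwise (to i)) ε ε>0)
    in N , λ m N≤m q ε≤q e →
         subst (λ e → MetricSpace.d X (s m e) (limit e) ≼ q) (strictlyInverseˡ e)
               (h m N≤m (from e) q ε≤q)

readerMonad : ∀ {n} {E : Set} → Fin n ↔ E → Monad CMet
readerMonad {n} {E} enum = record
  { T = record
    { F₀ = λ (X , complete) → Power X E , Power-complete enum {X} complete
    ; F₁ = λ f → record
      { fun = λ g → fun f ∘ g
      ; nonExpansive = λ g h q le e → _⇒_.nonExpansive f (g e) (h e) q (le e) }
    ; F-id = λ {X} _ _ → ≈-refl (proj₁ X)
    ; F-· = λ {_} {_} {Z} _ _ _ _ → ≈-refl (proj₁ Z)
    ; F-cong = λ p g e → p (g e) }
  ; η = record
    { at = λ X → record { fun = λ x _ → x ; nonExpansive = λ _ _ _ le _ → le }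
    ; natural = λ {_} {Y} _ _ _ → ≈-refl (proj₁ Y) }
  ; μ = record
    { at = λ X → record { fun = λ g e → g e e ; nonExpansive = λ _ _ _ le e → le e e }
    ; natural = λ {_} {Y} _ _ _ → ≈-refl (proj₁ Y) }
  ; unitˡ = λ X _ _ → ≈-refl (proj₁ X)
  ; unitʳ = λ X _ _ → ≈-refl (proj₁ X)
  ; μ-assoc = λ X _ _ → ≈-refl (proj₁ X)
  }
  where open MetricSpace using (≈-refl)

{-# OPTIONS --safe #-}

-- For a complete model B of ℛ and a map f : X → B, the assignment
-- g ↦ 𝗋(f (g e₁), …, f (g eₙ)) is a homomorphism X^E → B by the diagonal axiom and extends
-- f by idempotence. It is the only one, because every g ∈ X^E is 𝗋 applied to the constant
-- maps at its values. Hence X^E with 𝗋(g₁, …, gₙ)(eᵢ) = gᵢ(eᵢ) is the free complete model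
-- on X, and the monads induced by any two left adjoints of the forgetful functor are
-- isomorphic.
module Submission where

open import Defs
open import Data.Fin.Base using (Fin; toℕ; fromℕ<; combine; remQuot)
open import Data.Fin.Properties using (toℕ<n; fromℕ<-toℕ; remQuot-combine)
open import Data.List.Membership.Propositional.Properties using (∈-map⁺; ∈-tabulate⁺)
open import Data.List.Relation.Unary.Any using (here; there)
open import Data.Nat.Base using (ℕ; _*_)
open import Data.Nat.Properties using (_<?_)
open import Data.Product using (_×_; _,_; proj₁; proj₂; uncurry)
import Data.Rational.Properties as ℚ
open import Function.Base using (_∘_)
open import Function.Bundles using (_↔_; module Inverse; module Equivalence)
open import Relation.Binary.PropositionalEquality using (_≡_; refl; trans; cong)
open import Relation.Nullary.Decidable using (yes; no)
open import Relation.Nullary.Negation using (contradiction)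

-- Uniqueness of left adjoints, up to isomorphism of induced monads.

module UniqueAdjoint {o ℓ e o′ ℓ′ e′} {𝒞 : Category o ℓ e} {𝒟 : Category o′ ℓ′ e′}
                     {G : Functor 𝒟 𝒞} where
  private
    module 𝒞 = Category 𝒞
    module 𝒟 = Category 𝒟
    module G = Functor G
  open 𝒟 using (_·_; _≈_; module ≈)

  module _ (L M : LeftAdjoint G) where
    private
      module L = LeftAdjoint L
      module M = LeftAdjoint M

    -- The transpose of `M.unit.at A` across the adjunction `L`.
    compare : ∀ A → 𝒟.Hom (L.F.F₀ A) (M.F.F₀ A)
    compare A = L.counit.at (M.F.F₀ A) · L.F.F₁ (M.unit.at A)

    compare-natural : ∀ {A B} (f : 𝒞.Hom A B) →
                      compare B · L.F.F₁ f ≈ M.F.F₁ f · compare A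
    compare-natural f =
      ≈.trans (𝒟.assoc _ _ _)
      (≈.trans (𝒟.·-cong ≈.refl
        (≈.trans (≈.sym (L.F.F-· _ _))
        (≈.trans (L.F.F-cong (M.unit.natural f)) (L.F.F-· _ _))))
      (≈.trans (≈.sym (𝒟.assoc _ _ _))
      (≈.trans (𝒟.·-cong (L.counit.natural (M.F.F₁ f)) ≈.refl)
      (𝒟.assoc _ _ _))))

    -- Naturality of `L.unit` at `M.unit.at A` exposes the triangle identity `L.zag`. This is the
    -- unit law of the monad isomorphism.
    compare-unit : ∀ A → G.F₁ (compare A) 𝒞.· L.unit.at A 𝒞.≈ M.unit.at A
    compare-unit A =
      𝒞.≈.trans (𝒞.·-cong (G.F-· _ _) 𝒞.≈.refl)
      (𝒞.≈.trans (𝒞.assoc _ _ _)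
      (𝒞.≈.trans (𝒞.·-cong 𝒞.≈.refl (𝒞.≈.sym (L.unit.natural (M.unit.at A))))
      (𝒞.≈.trans (𝒞.≈.sym (𝒞.assoc _ _ _))
      (𝒞.≈.trans (𝒞.·-cong (L.zag (M.F.F₀ A)) 𝒞.≈.refl)
      (𝒞.idˡ _)))))

    -- Naturality of `L.counit` brings `M.counit` next to `M.unit`, where `M.zag` cancels them under
    -- `L.F`.
    compare-counit : ∀ B → M.counit.at B · compare (G.F₀ B) ≈ L.counit.at B
    compare-counit B =
      ≈.trans (≈.sym (𝒟.assoc _ _ _))
      (≈.trans (𝒟.·-cong (≈.sym (L.counit.natural (M.counit.at B))) ≈.refl)
      (≈.trans (𝒟.assoc _ _ _)
      (≈.trans (𝒟.·-cong ≈.refl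
        (≈.trans (≈.sym (L.F.F-· _ _)) (≈.trans (L.F.F-cong (M.zag B)) L.F.F-id)))
      (𝒟.idʳ _))))

    -- The multiplication of an induced monad is `G` of a counit, so this is the multiplication law
    -- before `G` is applied. It follows from naturality of `M.counit` at `compare A` and
    -- `compare-counit`.
    compare-μ : ∀ A → compare A · L.counit.at (L.F.F₀ A) ≈
                M.counit.at (M.F.F₀ A) · (M.F.F₁ (G.F₁ (compare A)) · compare (G.F₀ (L.F.F₀ A)))
    compare-μ A = ≈.sym
      (≈.trans (≈.sym (𝒟.assoc _ _ _))
      (≈.trans (𝒟.·-cong (M.counit.natural (compare A)) ≈.refl)
      (≈.trans (𝒟.assoc _ _ _)
      (𝒟.·-cong ≈.refl (compare-counit (L.F.F₀ A))))))

    compareᴺ : NatTrans (G ∘F L.F) (G ∘F M.F)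
    compareᴺ = record
      { at      = λ A → G.F₁ (compare A)
      ; natural = λ f → 𝒞.≈.trans (𝒞.≈.sym (G.F-· _ _))
          (𝒞.≈.trans (G.F-cong (compare-natural f)) (G.F-· _ _)) }

  -- Moving the unit of `L` past `compare L M` by naturality leaves the counit of `M` after
  -- `compare L M`. By `compare-counit` this is the counit of `L`, and `zig` finishes.
  compare-inverse : ∀ L M A → compare M L A · compare L M A ≈ 𝒟.id
  compare-inverse L M A =
    ≈.trans (𝒟.assoc _ _ _)
    (≈.trans (𝒟.·-cong ≈.refl (≈.sym (compare-natural L M (LeftAdjoint.unit.at L A))))
    (≈.trans (≈.sym (𝒟.assoc _ _ _))
    (≈.trans (𝒟.·-cong (compare-counit L M _) ≈.refl)
    (LeftAdjoint.zig L A))))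

  inducedMonad-unique : ∀ L M → inducedMonad L ≅ᴹ inducedMonad M
  inducedMonad-unique L M = record
    { to      = compareᴺ L M
    ; from    = compareᴺ M L
    ; to∘from = λ A → inverse M L A
    ; from∘to = λ A → inverse L M A
    ; to-η    = compare-unit L M
    ; to-μ    = λ A → 𝒞.≈.trans (𝒞.≈.sym (G.F-· _ _))
        (𝒞.≈.trans (G.F-cong (compare-μ L M A))
        (𝒞.≈.trans (G.F-· _ _) (𝒞.·-cong 𝒞.≈.refl (G.F-· _ _))))
    }
    where
    inverse : ∀ L M A → G.F₁ (compare M L A) 𝒞.· G.F₁ (compare L M A) 𝒞.≈ 𝒞.id
    inverse L M A = 𝒞.≈.trans (𝒞.≈.sym (G.F-· _ _))
      (𝒞.≈.trans (G.F-cong (compare-inverse L M A)) G.F-id)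

-- Distance bounds as membership of a single rational.

module Metric (X : MetricSpace) where
  open MetricSpace X

  ≼⇒≤∞ : ∀ {r ε} → r ≼ ε → r ≤∞ fromℚ≥0 ε
  ≼⇒≤∞ {r} r≼ε q ε≤q = [0,∞].upward r ε≤q r≼ε

  ≤∞⇒≼ : ∀ {r ε} → r ≤∞ fromℚ≥0 ε → r ≼ ε
  ≤∞⇒≼ {ε = ε} le = le ε ℚ.≤-refl

  ≈⇒d≼ : ∀ {x y} ε → x ≈ y → d x y ≼ ε
  ≈⇒d≼ ε x≈y = proj₁ (Equivalence.from separated x≈y) ε (0≤⁺ ε)

  d≼0⇒≈ : ∀ {x y} → d x y ≼ 0⁺ → x ≈ y
  d≼0⇒≈ {x} {y} le =
    Equivalence.to separated (≼⇒≤∞ {d x y} {0⁺} le , λ q _ → 0≤⁺ q)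

  d-trans : ∀ {x y z} ε ε′ → d x y ≼ ε → d y z ≼ ε′ → d x z ≼ (ε +⁺ ε′)
  d-trans {x} {y} {z} ε ε′ p q =
    -- The same pair `ε`, `ε′` witnesses the bound for every rational above the sum.
    triangle x y z (ε +⁺ ε′) λ q′ lt → ε , ε′ , p , q , ℚ.<⇒≤ lt

  d-resp-≈ : ∀ {x x′ y y′ ε} → x ≈ x′ → y ≈ y′ → d x y ≼ ε → d x′ y′ ≼ ε
  d-resp-≈ {x} {x′} {y} {y′} {ε} x≈x′ y≈y′ p =
    -- Two triangle inequalities give the bound `0 + ε + 0`, whose value equals that of `ε`.
    [0,∞].upward (d x′ y′) {p = (0⁺ +⁺ ε) +⁺ 0⁺} {q = ε}
      (ℚ.≤-reflexive (trans (ℚ.+-identityʳ _) (ℚ.+-identityˡ (value ε))))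
      (d-trans (0⁺ +⁺ ε) 0⁺ (d-trans 0⁺ ε (≈⇒d≼ 0⁺ (≈-sym x≈x′)) p) (≈⇒d≼ 0⁺ y≈y′))

  ≡⇒≈ : ∀ {x y} → x ≡ y → x ≈ y
  ≡⇒≈ refl = ≈-refl

-- Soundness of the deduction rules in a quantitative algebra.

module Soundness {S : Signature} (A : QuantAlgebra S) where
  open Signature S
  open QuantAlgebra A
  open MetricSpace space
  open Metric space

  Holds≼ : (Var → Carrier) → QuantEq S → Set
  Holds≼ ι (t =[ ε ] s) = d (eval ι t) (eval ι s) ≼ ε

  fromHolds : ∀ {ι} φ → Holds ι φ → Holds≼ ι φ
  fromHolds {ι} (t =[ ε ] s) = ≤∞⇒≼ {d (eval ι t) (eval ι s)} {ε}

  toHolds : ∀ {ι} φ → Holds≼ ι φ → Holds ι φ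
  toHolds {ι} (t =[ ε ] s) = ≼⇒≤∞ {d (eval ι t) (eval ι s)} {ε}

  -- Stated up to `≈` because the argument tuples agree only pointwise; non-expansive operations
  -- respect that.
  eval-[] : ∀ {V W : Set} (ι : W → Carrier) (σ : V → Term S W) t →
            eval ι (t [ σ ]) ≈ eval (eval ι ∘ σ) t
  eval-[] ι σ (var x)   = ≈-refl
  eval-[] ι σ (op f ts) = _⇒_.fun-cong (interp f) λ i → eval-[] ι σ (ts i)

  Holds-[] : ∀ {ι} σ φ → Holds ι (φ [ σ ]ᵉ) → Holds (eval ι ∘ σ) φ
  Holds-[] {ι} σ φ@(t =[ ε ] s) h = toHolds φ
    (d-resp-≈ {ε = ε} (eval-[] ι σ t) (eval-[] ι σ s) (fromHolds {ι} (φ [ σ ]ᵉ) h))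

  []-Holds : ∀ {ι} σ φ → Holds (eval ι ∘ σ) φ → Holds ι (φ [ σ ]ᵉ)
  []-Holds {ι} σ φ@(t =[ ε ] s) h = toHolds {ι} (φ [ σ ]ᵉ)
    (d-resp-≈ {ε = ε} (≈-sym (eval-[] ι σ t)) (≈-sym (eval-[] ι σ s)) (fromHolds φ h))

  Satisfies-isTheory : IsTheory Satisfies
  Satisfies-isTheory (reflexivity x) ι _ =
    toHolds {ι} (var x =[ 0⁺ ] var x) (≈⇒d≼ 0⁺ ≈-refl)
  Satisfies-isTheory (symmetry x y ε) ι hyp q ε≤q =
    proj₁ (d-sym (ι y) (ι x)) q (hyp (here refl) q ε≤q)
  Satisfies-isTheory (transitivity x y z ε ε′) ι hyp =
    toHolds {ι} (var x =[ ε +⁺ ε′ ] var y) (d-trans ε ε′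
      (fromHolds {ι} (var x =[ ε ] var z) (hyp (here refl)))
      (fromHolds {ι} (var z =[ ε′ ] var y) (hyp (there (here refl)))))
  Satisfies-isTheory (weakening x y ε ε′ 0<ε′) ι hyp =
    -- Weakening is the triangle inequality through `y`, with `d y y` bounded by `ε′`.
    toHolds {ι} (var x =[ ε +⁺ ε′ ] var y) (d-trans ε ε′
      (fromHolds {ι} (var x =[ ε ] var y) (hyp (here refl)))
      (≈⇒d≼ ε′ ≈-refl))
  Satisfies-isTheory (congruence f x y ε) ι hyp q ε≤q =
    _⇒_.nonExpansive (interp f) _ _ q λ i → hyp (∈-tabulate⁺ i) q ε≤q
  Satisfies-isTheory (continuity {Γ} {t} {s} {ε} h) ι hyp =
    -- Continuity is exactly the closedness of a set of rational upper bounds.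
    toHolds {ι} (t =[ ε ] s) ([0,∞].closed (d (eval ι t) (eval ι s)) λ ε′ ε<ε′ →
      fromHolds {ι} (t =[ ε′ ] s) (h ε′ ε<ε′ ι hyp))
  Satisfies-isTheory (substitution {Γ} {φ} σ p) ι hyp =
    []-Holds σ φ (p (eval ι ∘ σ) λ {ψ} ψ∈Γ → Holds-[] σ ψ (hyp (∈-map⁺ _[ σ ]ᵉ ψ∈Γ)))
  Satisfies-isTheory (assumption φ∈Γ) ι hyp = hyp φ∈Γ
  Satisfies-isTheory (cut h p) ι hyp = p ι λ φ∈Θ → h φ∈Θ ι hyp

  models-Generated : ∀ {𝒜} → (∀ {φ} → 𝒜 φ → Satisfies φ) →
                     ∀ {φ} → Generated 𝒜 φ → Satisfies φ
  models-Generated = Generated-smallest Satisfies-isTheory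

-- Matrices of values and the reader laws in a model.

variables : ∀ {n} → Fin n → Fin n → Var
variables i j = toℕ (combine i j)

assignment : ∀ {n} {A : Set} → A → (Fin n → Fin n → A) → Var → A
assignment {n} default a k with k <? n * n
... | yes k<n² = uncurry a (remQuot n (fromℕ< k<n²))
... | no  _    = default

assignment-variables : ∀ {n} {A : Set} (default : A) (a : Fin n → Fin n → A) i j →
                       assignment default a (variables i j) ≡ a i j
assignment-variables {n} default a i j with variables i j <? n * n
... | yes lt = cong (uncurry a)
      (trans (cong (remQuot n) (fromℕ<-toℕ (combine i j) lt)) (remQuot-combine i j))
... | no ≮   = contradiction (toℕ<n (combine i j)) ≮

module ReaderLaws {n : ℕ} (B : CompleteModel (ℛ n)) where
  open CompleteModel B
  open MetricSpace space
  open Metric space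

  read : (Fin n → Carrier) → Carrier
  read = fun (interp _)

  read-cong : ∀ {a b : Fin n → Carrier} → (∀ i → a i ≈ b i) → read a ≈ read b
  read-cong = _⇒_.fun-cong (interp _)

  read-idempotent : ∀ x → x ≈ read (λ _ → x)
  read-idempotent x =
    d≼0⇒≈ (models (axiom (idempotent 0)) (λ _ → x) (λ ()) 0⁺ ℚ.≤-refl)

  -- The axiom speaks of variables only; taking distinct ones for the entries lets an assignment
  -- realise an arbitrary matrix.
  read-diagonal : ∀ (a : Fin n → Fin n → Carrier) →
                  read (λ i → a i i) ≈ read (λ i → read (a i))
  read-diagonal a =
    ≈-trans (read-cong λ i → ≈-sym (ι≈ i i))
    (≈-trans (d≼0⇒≈ (models (axiom (diagonal variables)) ι (λ ()) 0⁺ ℚ.≤-refl))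
    (read-cong λ i → read-cong (ι≈ i)))
    where
    -- The default value of the assignment exists even for n = 0.
    ι : Var → Carrier
    ι = assignment (read λ i → a i i) a

    ι≈ : ∀ i j → ι (variables i j) ≈ a i j
    ι≈ i j = ≡⇒≈ (assignment-variables _ a i j)

-- The free complete model and its monad.

module _ {n : ℕ} {E : Set} (enum : Fin n ↔ E) where
  open Inverse enum using (to; from; strictlyInverseˡ; strictlyInverseʳ)
  private module R = Monad (readerMonad enum)

  readerAlgebra : MetricSpace → QuantAlgebra (readerSignature n)
  readerAlgebra X = record
    { space  = Power X E
    ; interp = λ _ → record
      { fun          = λ gs e → gs (from e) e
      ; nonExpansive = λ _ _ _ le e → le (from e) e } }

  readerModel : Category.Obj CMet → CompleteModel (ℛ n)
  readerModel X = record
    { algebra  = readerAlgebra (proj₁ X)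
    ; complete = proj₂ (R.T₀ X)
    ; models   = models-Generated axioms }
    where
    open QuantAlgebra (readerAlgebra (proj₁ X))
    open Soundness (readerAlgebra (proj₁ X))
    open Metric space
    open MetricSpace space

    axioms : ∀ {φ} → ReaderAxiom n φ → Satisfies φ
    -- In both axioms the two sides evaluate to the same function by computation.
    axioms (idempotent x) ι _ =
      ≼⇒≤∞ {d (ι x) (ι x)} {0⁺} (≈⇒d≼ 0⁺ ≈-refl)
    axioms (diagonal x) ι _ =
      ≼⇒≤∞ {d _ _} {0⁺} (≈⇒d≼ {x = λ e → ι (x (from e) (from e)) e} 0⁺ ≈-refl)

  readerAdjoint : LeftAdjoint (forgetful (ℛ n))
  readerAdjoint = record
    { F = record
      { F₀     = readerModel
      ; F₁     = λ {X} {Y} f → record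
        { map⇒ = R.T₁ {X} {Y} f ; hom = λ _ _ _ → ≈-refl (proj₁ Y) }
      ; F-id   = λ {X} → R.T-id {X}
      ; F-·    = λ {X} {Y} {Z} → R.T-· {X} {Y} {Z}
      ; F-cong = λ {X} {Y} {f} {g} → R.T-cong {X} {Y} {f} {g} }
    ; unit = record { at = R.η.at ; natural = λ {X} {Y} → R.η.natural {X} {Y} }
    ; counit = record
      { at      = evaluate
      ; natural = λ {B} {C} f g → ≈-sym (space C) (AlgHom.hom f _ (g ∘ to)) }
    -- Reading the constant maps at the values of `g` gives `g (to (from e))` at `e`.
    ; zig = λ X g e → Metric.≡⇒≈ (proj₁ X) (cong g (strictlyInverseˡ e))
    ; zag = λ B x → ≈-sym (space B) (ReaderLaws.read-idempotent B x)
    }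
    where
    open MetricSpace using (≈-refl; ≈-sym; ≈-trans)
    open CompleteModel using (space; algebra)

    evaluate : ∀ B → AlgHom (readerAlgebra (space B)) (algebra B)
    evaluate B = record
      { map⇒ = record
        { fun          = λ g → read (g ∘ to)
        ; nonExpansive = λ g h q le →
            _⇒_.nonExpansive (CompleteModel.interp B _) _ _ q (le ∘ to) }
      -- The operation on functions selects index `from (to i)` at `to i`. Once this is `i`, the
      -- diagonal law applies to the matrix `gs i (to j)`.
      ; hom = λ _ gs → ≈-trans (space B)
          (read-cong λ i → Metric.≡⇒≈ (space B) (cong (λ j → gs j (to i)) (strictlyInverseʳ i)))
          (read-diagonal λ i j → gs i (to j)) }
      where open ReaderLaws B

  induced≅reader : (L : LeftAdjoint (forgetful (ℛ n))) → inducedMonad L ≅ᴹ readerMonad enum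
  induced≅reader L = record
    { to      = record { at = I.to.at ; natural = I.to.natural }
    ; from    = record { at = I.from.at ; natural = I.from.natural }
    ; to∘from = I.to∘from
    ; from∘to = I.from∘to
    ; to-η    = I.to-η
    -- The multiplication induced by `readerAdjoint` sends `g` to `g (to (from e)) e`, that of the
    -- reader monad to `g e e`; only this field needs a correction.
    ; to-μ    = λ X x e → MetricSpace.≈-trans (proj₁ X) (I.to-μ X x e)
        (Metric.≡⇒≈ (proj₁ X) (cong (λ e′ → fun (I.to.at X) (fun (I.to.at (M.T₀ X)) x e′) e) (strictlyInverseˡ e)))
    }
    where
    module M = Monad (inducedMonad L)
    module I = _≅ᴹ_ (UniqueAdjoint.inducedMonad-unique L readerAdjoint)

theorem4p9 : (n : ℕ) (E : Set) (enum : Fin n ↔ E) →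
    LeftAdjoint (forgetful (ℛ n)) ×
    ((L : LeftAdjoint (forgetful (ℛ n))) → inducedMonad L ≅ᴹ readerMonad enum)
theorem4p9 n E enum = readerAdjoint enum , induced≅reader enum
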